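{- Let $L$ be a bounded distributive lattice, let $B$ be a finite discrete Boolean algebra, and let $\vdash$ be the entailment relation of lattice maps $L\to B$ on $L\times B$ (generated by the axioms listed in the context). For every finite subset $X$ of $L\times B$, the following are equivalent: (1) $X\vdash\emptyset$; (2) there is an atom $e\in\mathrm{At}\,B$ such that $$\bigwedge_{a\geq e}\bigwedge X_a\ \leq\ \bigvee_{a\geq e}\bigvee X_{ -a}\quad\text{in } L.$$
   Context: Reasoning is constructive (formalizable in constructive Zermelo–Fraenkel set theory CZF). A set $S$ is finite if there are $n\in\mathbb N$ and a surjection $\{1,\dots,n\}\to S$; it is discrete if its equality is decidable. Lattices are distributive and bounded, with top $1$ (the empty meet) and bottom $0$ (the empty join); lattice maps preserve $\wedge,\vee,0,1$. $-a$ is the complement of $a$ in a Boolean algebra. $\mathrm{At}\,B$ is the set of atoms of $B$, i.e. minimal non-zero elements. An entailment relation on a set $S$ is a relation $\vdash$ between finite subsets of $S$ satisfying (R): $X\vdash Y$ whenever $X$ and $Y$ have a common element; (M): $X\vdash Y$ implies $X\cup X'\vdash Y\cup Y'$; (T): $X\vdash Y\cup\{x\}$ and $X\cup\{x\}\vdash Y$ imply $X\vdash Y$. Commas denote union, singleton braces are dropped, and an empty side is left blank. The entailment relation generated by a set of axioms (pairs of finite subsets) is the least one containing them. The entailment relation of lattice maps $L\to B$ is the entailment relation on $L\times B$ generated by all instances of: (s) $(x,a),(x,b)\vdash$ for $a\neq b$; ($\wedge$) $(x,a),(y,b)\vdash(x\wedge y,a\wedge b)$; ($\vee$) $(x,a),(y,b)\vdash(x\vee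 y,a\vee b)$; (0) $\vdash(0_L,0_B)$; (1) $\vdash(1_L,1_B)$; (t) $\vdash\{(x,a):a\in B\}$. For a finite $X\subseteq L\times B$ and $a\in B$, $X_a=\{x\in L:(x,a)\in X\}$. In $\bigwedge_{a\geq e}$ and $\bigvee_{a\geq e}$, $a$ ranges over all elements of $B$ with $a\geq e$. -}

module Defs where

open import Algebra.Definitions using (_DistributesOverˡ_)
open import Data.Fin.Base using (Fin)
open import Data.List.Base using (List; []; _∷_; [_]; map; filter; foldr; tabulate)
import Data.List.Membership.Setoid as Membership
import Data.List.Relation.Binary.Subset.Setoid as Subset
open import Data.Product.Base using (∃; _×_; _,_; proj₁; proj₂)
open import Data.Product.Relation.Binary.Pointwise.NonDependent using (×-setoid)
open import Function.Bundles using (Surjection)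
open import Level using (Level; _⊔_; suc)
open import Relation.Binary.Bundles using (Setoid)
open import Relation.Binary.Core using (Rel)
open import Relation.Binary.Definitions using (Decidable)
open import Relation.Binary.Lattice using (BoundedLattice; BooleanAlgebra)
open import Relation.Binary.Lattice.Properties.MeetSemilattice using (≈-dec⇒≤-dec)
open import Relation.Binary.PropositionalEquality using (setoid)
open import Relation.Nullary.Negation using (¬_)

record BoundedDistributiveLattice c ℓ₁ ℓ₂ : Set (suc (c ⊔ ℓ₁ ⊔ ℓ₂)) where
  field
    boundedLattice : BoundedLattice c ℓ₁ ℓ₂

  open BoundedLattice boundedLattice public

  field
    ∧-distribˡ-∨ : _DistributesOverˡ_ _≈_ _∧_ _∨_

-- Repetitions are allowed, so a finite set need not be discrete.
Finite : ∀ {a ℓ} → Setoid a ℓ → Set (a ⊔ ℓ)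
Finite S = ∃ λ n → Surjection (setoid (Fin n)) S

elements : ∀ {a ℓ} {S : Setoid a ℓ} → Finite S → List (Setoid.Carrier S)
elements (_ , enum) = tabulate (Surjection.to enum)

Discrete : ∀ {a ℓ} → Setoid a ℓ → Set (a ⊔ ℓ)
Discrete S = Decidable (Setoid._≈_ S)

-- A finite subset of a setoid S is given by a list of its elements; two lists
-- present the same finite subset when each is contained in the other, where
-- membership is up to the equality of S.
module Entailment {s ℓ} (S : Setoid s ℓ) where

  open Setoid S using () renaming (Carrier to A)
  open Membership S using (_∈_)
  open Subset S using (_⊆_)

  FiniteSubset : Set s
  FiniteSubset = List A

  -- The least entailment relation containing the axioms Ax.  X′ ranges over
  -- the supersets X ∪ X′ of X in (M) (and likewise Y′), which also makes the
  -- relation independent of the lists presenting the two finite subsets.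
  data Generated {r} (Ax : Rel FiniteSubset r) : Rel FiniteSubset (s ⊔ ℓ ⊔ r) where
    axiom : ∀ {X Y} → Ax X Y → Generated Ax X Y
    R     : ∀ {X Y x} → x ∈ X → x ∈ Y → Generated Ax X Y
    M     : ∀ {X X′ Y Y′} → X ⊆ X′ → Y ⊆ Y′ → Generated Ax X Y → Generated Ax X′ Y′
    T     : ∀ {X Y} x → Generated Ax X (x ∷ Y) → Generated Ax (x ∷ X) Y → Generated Ax X Y

module LatticeMaps
  {c₁ ℓ₁ ℓ₂ c₂ ℓ₃ ℓ₄ : Level}
  (L : BoundedDistributiveLattice c₁ ℓ₁ ℓ₂)
  (B : BooleanAlgebra c₂ ℓ₃ ℓ₄)
  (finite : Finite (BooleanAlgebra.setoid B))
  (_≟_ : Discrete (BooleanAlgebra.setoid B))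
  where

  private
    module L = BoundedDistributiveLattice L
    module B = BooleanAlgebra B

  open Entailment (×-setoid L.setoid B.setoid) public

  data Axiom : Rel FiniteSubset (c₁ ⊔ c₂ ⊔ ℓ₃) where
    ax-s : ∀ {x a b} → ¬ (a B.≈ b) → Axiom ((x , a) ∷ (x , b) ∷ []) []
    ax-∧ : ∀ {x y a b} → Axiom ((x , a) ∷ (y , b) ∷ []) [ (x L.∧ y , a B.∧ b) ]
    ax-∨ : ∀ {x y a b} → Axiom ((x , a) ∷ (y , b) ∷ []) [ (x L.∨ y , a B.∨ b) ]
    ax-0 : Axiom [] [ (L.⊥ , B.⊥) ]
    ax-1 : Axiom [] [ (L.⊤ , B.⊤) ]
    ax-t : ∀ {x} → Axiom [] (map (x ,_) (elements finite))

  infix 4 _⊢_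
  _⊢_ : Rel FiniteSubset _
  _⊢_ = Generated Axiom

  -_ : B.Carrier → B.Carrier
  -_ = B.¬_

  IsAtom : B.Carrier → Set _
  IsAtom e = ¬ (e B.≈ B.⊥) × (∀ b → ¬ (b B.≈ B.⊥) → b B.≤ e → b B.≈ e)

  _≤L_ : Rel L.Carrier ℓ₂
  _≤L_ = L._≤_

  ⋀ ⋁ : List L.Carrier → L.Carrier
  ⋀ = foldr L._∧_ L.⊤
  ⋁ = foldr L._∨_ L.⊥

  -- X ⟨ a ⟩ is X_a = { x ∣ (x , a) ∈ X }.
  _⟨_⟩ : FiniteSubset → B.Carrier → List L.Carrier
  X ⟨ a ⟩ = map proj₁ (filter (λ p → proj₂ p ≟ a) X)

  _≤?_ : Decidable B._≤_
  _≤?_ = ≈-dec⇒≤-dec B.meetSemilattice _≟_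

  above : B.Carrier → List B.Carrier
  above e = filter (e ≤?_) (elements finite)

  ⋀[a≥_]_ ⋁[a≥_]_ : B.Carrier → (B.Carrier → L.Carrier) → L.Carrier
  ⋀[a≥ e ] f = ⋀ (map f (above e))
  ⋁[a≥ e ] f = ⋁ (map f (above e))

  infix 4 _≤L_
  infix 9 -_
  infix 10 _⟨_⟩

{-# OPTIONS --safe #-}
module Submission where

-- Write C(e, Z) for the inequality of (2) at the atom e.  From C(e, X), the
-- axioms (∧), (∨), (0), (1) derive from X values ≥ e for the left side and
-- values ≤ - e for the right side; these contradict (s) because left ≤ right.
-- Conversely, by (s) and (t) a pair (y , b) on the right amounts to pairs
-- (y , b′) with b′ ≠ b on the left.  This suggests interpreting X ⊢ Y as: every
-- Z containing X and, for each (y , b) in Y, some (y , b′) with b′ ≠ b satisfies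
-- C(e, Z) for some atom e.  All the rules are sound for this interpretation.  For
-- the cut with x, every b has an atom e with C(e, (x , b) ∷ Z), i.e. C(e, Z) with
-- x added to the left side if e ≤ b and to the right side if e ≤ - b.
-- Flipping b at one atom after the other yields an atom for which both hold, and
-- cut in L removes x.

open import Defs
open import Data.List.Base using (List; []; _∷_; [_]; map)
import Data.List.Membership.Propositional.Properties as ∈ₚ
open import Data.List.Membership.Propositional using () renaming (_∈_ to _∈≡_)
import Data.List.Membership.Setoid as Membership
import Data.List.Membership.Setoid.Properties as ∈ₛ
open import Data.List.Relation.Unary.All as All using (All; []; _∷_)
import Data.List.Relation.Unary.All.Properties as All
open import Data.List.Relation.Unary.Any as Any using (here; there)
import Data.List.Relation.Unary.Any.Properties as Any
import Data.List.Relation.Binary.Subset.Setoid as Subset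
import Data.List.Relation.Binary.Subset.Setoid.Properties as Subsetₚ
open import Data.Product.Base using (∃; _×_; _,_; proj₁; proj₂)
open import Data.Product.Relation.Binary.Pointwise.NonDependent using (×-setoid)
open import Data.Sum.Base using (_⊎_; inj₁; inj₂)
open import Function.Base using (_∘_)
open import Function.Bundles using (_⇔_; mk⇔; Surjection)
open import Relation.Binary.Bundles using (Setoid)
open import Relation.Binary.Lattice using (BooleanAlgebra)
import Relation.Binary.Lattice.Properties.HeytingAlgebra as HeytingAlgebraₚ
open import Relation.Binary.PropositionalEquality.Core using (refl)
open import Relation.Nullary.Decidable using (yes; no)
open import Relation.Nullary.Negation using (¬_; contradiction)

module _
  {c₁ ℓ₁ ℓ₂ c₂ ℓ₃ ℓ₄}
  (L : BoundedDistributiveLattice c₁ ℓ₁ ℓ₂)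
  (B : BooleanAlgebra c₂ ℓ₃ ℓ₄)
  (finite : Finite (BooleanAlgebra.setoid B))
  (_≟_ : Discrete (BooleanAlgebra.setoid B))
  where

  private
    module L = BoundedDistributiveLattice L
    module B where
      open BooleanAlgebra B public
      open HeytingAlgebraₚ heytingAlgebra public using (∧-distribˡ-∨-≤)

    S = ×-setoid L.setoid B.setoid
    module S = Setoid S

  open LatticeMaps L B finite _≟_
  open Membership S using (_∈_)
  open Subset S using (_⊆_)

  private
    variable
      a b d e : B.Carrier
      x y m j : L.Carrier
      X Y Z : FiniteSubset

  -- Boolean algebra

  -- `b ⇨ c` is by definition `- b ∨ c`, so transposing yields `- b ∨ ⊥`.
  ∧⊥⇒≤- : a B.∧ b B.≤ B.⊥ → a B.≤ - b
  ∧⊥⇒≤- h = B.trans (B.transpose-⇨ h) (B.∨-least B.refl (B.minimum _))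

  ≤-⇒∧⊥ : a B.≤ - b → a B.∧ b B.≤ B.⊥
  ≤-⇒∧⊥ h = B.transpose-∧ (B.trans h (B.x≤x∨y _ _))

  ∧-⊥⇒≤ : a B.∧ - b B.≤ B.⊥ → a B.≤ b
  ∧-⊥⇒≤ {a} {b} h =
    -- The second factor is excluded middle: `b ⇨ b` unfolds to `- b ∨ b`.
    B.trans (B.∧-greatest B.refl (B.transpose-⇨ (B.x∧y≤y a b)))
    (B.trans (B.∧-distribˡ-∨-≤ a (- b) b)
      (B.∨-least (B.trans h (B.minimum b)) (B.x∧y≤y a b)))

  -‿antitone : a B.≤ b → - b B.≤ - a
  -‿antitone {a} {b} a≤b =
    ∧⊥⇒≤- (B.trans (B.∧-greatest (B.x∧y≤x _ _) (B.trans (B.x∧y≤y _ _) a≤b)) (≤-⇒∧⊥ {b = b} B.refl))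

  ≤-‿swap : a B.≤ - b → b B.≤ - a
  ≤-‿swap h = ∧⊥⇒≤- (B.trans (B.∧-greatest (B.x∧y≤y _ _) (B.x∧y≤x _ _)) (≤-⇒∧⊥ h))

  ≈-‿swap : a B.≈ - b → b B.≈ - a
  ≈-‿swap a≈-b = B.antisym (≤-‿swap (B.reflexive a≈-b))
    (∧-⊥⇒≤ (B.trans (B.∧-greatest (B.x∧y≤x _ _) (B.trans (B.x∧y≤y _ _) (B.reflexive (B.Eq.sym a≈-b))))
                    (≤-⇒∧⊥ B.refl)))

  -- Atoms: existence, primality, separation of elements

  ∈-elements : ∀ a → ∃ λ a′ → a′ ∈≡ elements finite × a B.≈ a′
  ∈-elements a = _ , ∈ₚ.∈-tabulate⁺ (to⁻ a) , B.Eq.sym (to∘to⁻ a)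
    where open Surjection (proj₂ finite)

  -- Decidable equality settles whether `e ∧ a` is zero; if not, minimality makes it equal to `e`.
  atom-prime : IsAtom e → ∀ a → e B.≤ a ⊎ e B.≤ - a
  atom-prime {e} (_ , minimal) a with (e B.∧ a) ≟ B.⊥
  ... | yes ≈⊥ = inj₂ (∧⊥⇒≤- (B.reflexive ≈⊥))
  ... | no ≉⊥ = inj₁ (B.trans (B.reflexive (B.Eq.sym (minimal _ ≉⊥ (B.x∧y≤x e a)))) (B.x∧y≤y e a))

  atom-consistent : IsAtom e → e B.≤ a → ¬ e B.≤ - a
  atom-consistent (e≉⊥ , _) e≤a e≤-a =
    e≉⊥ (B.antisym (B.trans (B.∧-greatest B.refl e≤a) (≤-⇒∧⊥ e≤-a)) (B.minimum _))

  distinct-atoms : IsAtom d → IsAtom e → ¬ d B.≈ e → d B.≤ - e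
  distinct-atoms {d} {e} atom-d (_ , minimal) d≉e with atom-prime atom-d e
  ... | inj₁ d≤e = contradiction (minimal d (proj₁ atom-d) d≤e) d≉e
  ... | inj₂ d≤-e = d≤-e

  -- For bs = elements finite, the resulting e is an atom.
  refine : (bs : List B.Carrier) → ¬ a B.≈ B.⊥ →
    ∃ λ e → ¬ e B.≈ B.⊥ × e B.≤ a × All (λ b → b B.∧ e B.≈ B.⊥ ⊎ e B.≤ b) bs
  refine [] a≉⊥ = _ , a≉⊥ , B.refl , []
  refine {a} (b ∷ bs) a≉⊥ with refine bs a≉⊥
  ... | e , e≉⊥ , e≤a , es with (b B.∧ e) ≟ B.⊥
  ...   | yes ≈⊥ = e , e≉⊥ , e≤a , inj₁ ≈⊥ ∷ es
  -- Shrinking to `b ∧ e` settles `b`; both alternatives for the entries of `bs` are inherited by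
  -- smaller elements.
  ...   | no ≉⊥ = b B.∧ e , ≉⊥ , B.trans (B.x∧y≤y b e) e≤a , inj₂ (B.x∧y≤x b e) ∷ All.map restrict es
    where
    restrict : ∀ {c} → c B.∧ e B.≈ B.⊥ ⊎ e B.≤ c → c B.∧ (b B.∧ e) B.≈ B.⊥ ⊎ b B.∧ e B.≤ c
    restrict (inj₁ h) = inj₁ (B.antisym
      (B.trans (B.∧-greatest (B.x∧y≤x _ _) (B.trans (B.x∧y≤y _ _) (B.x∧y≤y b e))) (B.reflexive h))
      (B.minimum _))
    restrict (inj₂ e≤c) = inj₂ (B.trans (B.x∧y≤y b e) e≤c)

  atom-below : ¬ a B.≈ B.⊥ → ∃ λ e → IsAtom e × e B.≤ a
  atom-below a≉⊥ with refine (elements finite) a≉⊥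
  ... | e , e≉⊥ , e≤a , es = e , (e≉⊥ , minimal) , e≤a
    where
    minimal : ∀ b → ¬ b B.≈ B.⊥ → b B.≤ e → b B.≈ e
    -- The listed copy `b′` of a nonzero `b ≤ e` is not disjoint from `e`, so it lies above `e`.
    minimal b b≉⊥ b≤e with ∈-elements b
    ... | b′ , b′∈ , b≈b′ with All.lookup es b′∈
    ...   | inj₁ b′∧e≈⊥ = contradiction
      (B.antisym (B.trans (B.∧-greatest (B.reflexive b≈b′) b≤e) (B.reflexive b′∧e≈⊥)) (B.minimum b)) b≉⊥
    ...   | inj₂ e≤b′ = B.antisym b≤e (B.trans e≤b′ (B.reflexive (B.Eq.sym b≈b′)))

  separate-≰ : ¬ a B.≤ b → ∃ λ e → IsAtom e × e B.≤ a × e B.≤ - b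
  separate-≰ {a} {b} a≰b with atom-below {a B.∧ - b} (a≰b ∘ ∧-⊥⇒≤ ∘ B.reflexive)
  ... | e , atom , e≤ = e , atom , B.trans e≤ (B.x∧y≤x _ _) , B.trans e≤ (B.x∧y≤y _ _)

  separate : ¬ a B.≈ b → ∃ λ e → IsAtom e × (e B.≤ a × e B.≤ - b ⊎ e B.≤ b × e B.≤ - a)
  separate {a} {b} a≉b with a ≤? b
  ... | no a≰b = let e , atom , h = separate-≰ a≰b in e , atom , inj₁ h
  ... | yes a≤b = let e , atom , h = separate-≰ (λ b≤a → a≉b (B.antisym a≤b b≤a)) in e , atom , inj₂ h

  -- `b′` is `b` with its value at `e` reversed. Agreement below `- e` is stated only from `b′` to
  -- `b`, the direction in which `eliminate` transports collapses.
  FlippedAt : B.Carrier → B.Carrier → B.Carrier → Set _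
  FlippedAt e b b′ =
    (e B.≤ b × e B.≤ - b′ ⊎ e B.≤ b′ × e B.≤ - b) ×
    (∀ {d} → d B.≤ - e → (d B.≤ b′ → d B.≤ b) × (d B.≤ - b′ → d B.≤ - b))

  flip : IsAtom e → ∀ b → ∃ (FlippedAt e b)
  flip {e} atom b with atom-prime atom b
  ... | inj₁ e≤b = b B.∧ - e , inj₁ (e≤b , ≤-‿swap (B.x∧y≤y b (- e))) , λ d≤-e →
    (λ d≤b′ → B.trans d≤b′ (B.x∧y≤x b (- e))) ,
    (λ d≤-b′ → ∧⊥⇒≤- (B.trans
      (B.∧-greatest (B.x∧y≤x _ _) (B.∧-greatest (B.x∧y≤y _ _) (B.trans (B.x∧y≤x _ _) d≤-e)))
      (≤-⇒∧⊥ d≤-b′)))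
  ... | inj₂ e≤-b = b B.∨ e , inj₂ (B.y≤x∨y b e , e≤-b) , λ {d} d≤-e →
    (λ d≤b′ → B.trans (B.∧-greatest B.refl d≤b′) (B.trans (B.∧-distribˡ-∨-≤ d b e)
      (B.∨-least (B.x∧y≤y d b) (B.trans (≤-⇒∧⊥ d≤-e) (B.minimum b))))) ,
    (λ d≤-b′ → B.trans d≤-b′ (-‿antitone (B.x≤x∨y b e)))

  -- The inequality of (2)

  LowerBound UpperBound : B.Carrier → FiniteSubset → L.Carrier → Set _
  LowerBound e Z m = ∀ {x a} → (x , a) ∈ Z → e B.≤ a → m L.≤ x
  UpperBound e Z j = ∀ {x a} → (x , a) ∈ Z → e B.≤ - a → x L.≤ j

  -- Quantifying over bounds makes the inequality independent of the list Z.
  Collapses : B.Carrier → FiniteSubset → Set _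
  Collapses e Z = ∀ m j → LowerBound e Z m → UpperBound e Z j → m L.≤ j

  Inconsistent : FiniteSubset → Set _
  Inconsistent Z = ∃ λ e → IsAtom e × Collapses e Z

  Collapses-resp-≈ : d B.≈ e → Collapses d Z → Collapses e Z
  Collapses-resp-≈ d≈e collapses m j lower upper = collapses m j
    (λ x∈Z d≤a → lower x∈Z (B.trans (B.reflexive (B.Eq.sym d≈e)) d≤a))
    (λ x∈Z d≤-a → upper x∈Z (B.trans (B.reflexive (B.Eq.sym d≈e)) d≤-a))

  lower-∷ : (e B.≤ a → m L.≤ x) → LowerBound e Z m → LowerBound e ((x , a) ∷ Z) m
  lower-∷ m≤x lower (here (y≈x , b≈a)) e≤b =
    L.trans (m≤x (B.trans e≤b (B.reflexive b≈a))) (L.reflexive (L.Eq.sym y≈x))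
  lower-∷ m≤x lower (there p) = lower p

  upper-∷ : (e B.≤ - a → x L.≤ j) → UpperBound e Z j → UpperBound e ((x , a) ∷ Z) j
  upper-∷ x≤j upper (here (y≈x , b≈a)) e≤-b =
    L.trans (L.reflexive y≈x) (x≤j (B.trans e≤-b (-‿antitone (B.reflexive (B.Eq.sym b≈a)))))
  upper-∷ x≤j upper (there p) = upper p

  -- Removing a pair by cuts at atoms

  collapses-∷ : (e B.≤ a → e B.≤ b) → (e B.≤ - a → e B.≤ - b) →
    Collapses e ((x , a) ∷ Z) → Collapses e ((x , b) ∷ Z)
  collapses-∷ pos neg collapses m j lower upper = collapses m j
    (lower-∷ (λ e≤a → lower (here S.refl) (pos e≤a)) (λ p → lower (there p)))
    (upper-∷ (λ e≤-a → upper (here S.refl) (neg e≤-a)) (λ p → upper (there p)))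

  -- Cut in a distributive lattice: `(x , a)` adds `x` to the left side only and `(x , b)` to the
  -- right side only, giving `m ∧ x ≤ j` and `m ≤ x ∨ j`.
  resolve : IsAtom e → e B.≤ a → e B.≤ - b →
    Collapses e ((x , a) ∷ Z) → Collapses e ((x , b) ∷ Z) → Collapses e Z
  resolve {x = x} atom e≤a e≤-b collapses-a collapses-b m j lower upper =
    L.trans (L.∧-greatest L.refl m≤x∨j)
      (L.trans (L.reflexive (L.∧-distribˡ-∨ m x j)) (L.∨-least m∧x≤j (L.x∧y≤y m j)))
    where
    m∧x≤j = collapses-a (m L.∧ x) j
      (lower-∷ (λ _ → L.x∧y≤y m x) (λ p e≤c → L.trans (L.x∧y≤x m x) (lower p e≤c)))
      (upper-∷ (λ e≤-a → contradiction e≤-a (atom-consistent atom e≤a)) upper)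
    m≤x∨j = collapses-b m (x L.∨ j)
      (lower-∷ (λ e≤b → contradiction e≤-b (atom-consistent atom e≤b)) lower)
      (upper-∷ (λ _ → L.x≤x∨y x j) (λ p e≤-c → L.trans (upper p e≤-c) (L.y≤x∨y x j)))

  -- `es` lists the places where a collapse may still occur. Each step removes one; when none is
  -- left, any `b`, here `⊤`, is in the first case.
  eliminate : (es : List B.Carrier) →
    (∀ b → Inconsistent Z ⊎
      ∃ λ e → IsAtom e × Any.Any (e B.≈_) es × Collapses e ((x , b) ∷ Z)) →
    Inconsistent Z
  eliminate [] h with h B.⊤
  ... | inj₁ done = done
  ... | inj₂ (_ , _ , () , _)
  eliminate {Z} {x} (e₀ ∷ es) h = eliminate es h′
    where
    Goal : B.Carrier → Set _
    Goal b = Inconsistent Z ⊎ ∃ λ e → IsAtom e × Any.Any (e B.≈_) es × Collapses e ((x , b) ∷ Z)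

    h′ : ∀ b → Goal b
    h′ b with h b
    ... | inj₁ done = inj₁ done
    ... | inj₂ (e , atom , there e∈es , collapses) = inj₂ (e , atom , e∈es , collapses)
    -- The collapse for `b` is at the place being removed, so the hypothesis is also applied to `b`
    -- flipped there. Collapses at the same atom resolve; one at another atom `d` transfers back to
    -- `b`, and `d` lies in the rest of the list.
    ... | inj₂ (e , atom , here e≈e₀ , collapses) with flip atom b
    ...   | b′ , opposite , agree with h b′
    ...     | inj₁ done = inj₁ done
    ...     | inj₂ (d , atom-d , d∈ , collapses-d) with d ≟ e
    ...       | yes d≈e = inj₁ (e , atom , resolve′ opposite (Collapses-resp-≈ d≈e collapses-d))
      where
      resolve′ : e B.≤ b × e B.≤ - b′ ⊎ e B.≤ b′ × e B.≤ - b →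
        Collapses e ((x , b′) ∷ Z) → Collapses e Z
      resolve′ (inj₁ (e≤b , e≤-b′)) c = resolve atom e≤b e≤-b′ collapses c
      resolve′ (inj₂ (e≤b′ , e≤-b)) c = resolve atom e≤b′ e≤-b c collapses
    ...       | no d≉e with d∈
    ...         | here d≈e₀ = contradiction (B.Eq.trans d≈e₀ (B.Eq.sym e≈e₀)) d≉e
    ...         | there d∈es = inj₂ (d , atom-d , d∈es ,
      collapses-∷ (proj₁ agree′) (proj₂ agree′) collapses-d)
      where agree′ = agree (distinct-atoms atom-d atom d≉e)

  inconsistent-∷ : (∀ b → Inconsistent ((x , b) ∷ Z)) → Inconsistent Z
  inconsistent-∷ h = eliminate (elements finite) λ b →
    let e , atom , collapses = h b
        e′ , e′∈ , e≈e′ = ∈-elements e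
    in inj₂ (e , atom , Any.map (λ { refl → e≈e′ }) e′∈ , collapses)

  -- Soundness

  Refutes : FiniteSubset → FiniteSubset → Set _
  Refutes Z Y = ∀ {y b} → (y , b) ∈ Y → ∃ λ b′ → ¬ b′ B.≈ b × (y , b′) ∈ Z

  infix 4 _⊩_
  -- Ranging over all `Z` makes (M) immediate and lets (T) apply its premises to `Z` enlarged by a
  -- pair.
  _⊩_ : FiniteSubset → FiniteSubset → Set _
  X ⊩ Y = ∀ Z → X ⊆ Z → Refutes Z Y → Inconsistent Z

  -- At an atom separating `a` from `b`, `x` occurs on both sides of the inequality.
  clash : ¬ a B.≈ b → (x , a) ∈ Z → (x , b) ∈ Z → Inconsistent Z
  clash a≉b a∈Z b∈Z with separate a≉b
  ... | e , atom , inj₁ (e≤a , e≤-b) = e , atom , λ m j lower upper →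
    L.trans (lower a∈Z e≤a) (upper b∈Z e≤-b)
  ... | e , atom , inj₂ (e≤b , e≤-a) = e , atom , λ m j lower upper →
    L.trans (lower b∈Z e≤b) (upper a∈Z e≤-a)

  axiom-sound : Axiom X Y → X ⊩ Y
  axiom-sound (ax-s a≉b) Z X⊆Z _ = clash a≉b (X⊆Z (here S.refl)) (X⊆Z (there (here S.refl)))
  axiom-sound (ax-∧ {x} {y} {a} {b}) Z X⊆Z refutes with refutes (here S.refl)
  ... | c , c≉ , c∈Z with separate c≉
  ...   | e , atom , inj₂ (e≤a∧b , e≤-c) = e , atom , λ m j lower upper →
    L.trans (L.∧-greatest
      (lower (X⊆Z (here S.refl)) (B.trans e≤a∧b (B.x∧y≤x a b)))
      (lower (X⊆Z (there (here S.refl))) (B.trans e≤a∧b (B.x∧y≤y a b))))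
      (upper c∈Z e≤-c)
  -- By primality an atom below `- (a ∧ b)` is below `- a` or `- b`; the remaining case is absurd.
  ...   | e , atom , inj₁ (e≤c , e≤-a∧b) with atom-prime atom a
  ...     | inj₂ e≤-a = e , atom , λ m j lower upper →
    L.trans (lower c∈Z e≤c) (L.trans (L.x∧y≤x x y) (upper (X⊆Z (here S.refl)) e≤-a))
  ...     | inj₁ e≤a with atom-prime atom b
  ...       | inj₂ e≤-b = e , atom , λ m j lower upper →
    L.trans (lower c∈Z e≤c) (L.trans (L.x∧y≤y x y) (upper (X⊆Z (there (here S.refl))) e≤-b))
  ...       | inj₁ e≤b = contradiction e≤-a∧b (atom-consistent atom (B.∧-greatest e≤a e≤b))
  axiom-sound (ax-∨ {x} {y} {a} {b}) Z X⊆Z refutes with refutes (here S.refl)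
  ... | c , c≉ , c∈Z with separate c≉
  ...   | e , atom , inj₁ (e≤c , e≤-a∨b) = e , atom , λ m j lower upper →
    L.trans (lower c∈Z e≤c) (L.∨-least
      (upper (X⊆Z (here S.refl)) (B.trans e≤-a∨b (-‿antitone (B.x≤x∨y a b))))
      (upper (X⊆Z (there (here S.refl))) (B.trans e≤-a∨b (-‿antitone (B.y≤x∨y a b)))))
  ...   | e , atom , inj₂ (e≤a∨b , e≤-c) with atom-prime atom a
  ...     | inj₁ e≤a = e , atom , λ m j lower upper →
    L.trans (lower (X⊆Z (here S.refl)) e≤a) (L.trans (L.x≤x∨y x y) (upper c∈Z e≤-c))
  ...     | inj₂ e≤-a with atom-prime atom b
  ...       | inj₁ e≤b = e , atom , λ m j lower upper →
    L.trans (lower (X⊆Z (there (here S.refl))) e≤b) (L.trans (L.y≤x∨y x y) (upper c∈Z e≤-c))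
  ...       | inj₂ e≤-b = contradiction
    (≤-‿swap (B.∨-least (≤-‿swap e≤-a) (≤-‿swap e≤-b))) (atom-consistent atom e≤a∨b)
  axiom-sound ax-0 Z _ refutes with refutes (here S.refl)
  ... | c , c≉⊥ , c∈Z with atom-below c≉⊥
  ...   | e , atom , e≤c = e , atom , λ m j lower upper → L.trans (lower c∈Z e≤c) (L.minimum j)
  axiom-sound ax-1 Z _ refutes with refutes (here S.refl)
  ... | c , c≉⊤ , c∈Z with separate-≰ (λ ⊤≤c → c≉⊤ (B.antisym (B.maximum c) ⊤≤c))
  ...   | e , atom , _ , e≤-c = e , atom , λ m j lower upper → L.trans (L.maximum m) (upper c∈Z e≤-c)
  axiom-sound (ax-t {x}) Z _ refutes =
    -- Refuting the arbitrary value `⊤` gives one value of `x` in `Z`; refuting that value gives a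
    -- second, different one.
    let b , _ , b∈Z = refuted B.⊤
        c , c≉b , c∈Z = refuted b
    in clash c≉b c∈Z b∈Z
    where
    refuted : ∀ a → ∃ λ b → ¬ b B.≈ a × (x , b) ∈ Z
    refuted a with ∈-elements a
    ... | a′ , a′∈ , a≈a′ = refutes (Any.map⁺ (Any.map (λ { refl → L.Eq.refl , a≈a′ }) a′∈))

  sound : X ⊢ Y → X ⊩ Y
  sound (axiom ax) = axiom-sound ax
  sound (R x∈X x∈Y) Z X⊆Z refutes with refutes x∈Y
  ... | b , b≉a , b∈Z = clash b≉a b∈Z (X⊆Z x∈X)
  sound (M X⊆X′ Y⊆Y′ X⊢Y) Z X′⊆Z refutes =
    sound X⊢Y Z (λ p → X′⊆Z (X⊆X′ p)) (λ p → refutes (Y⊆Y′ p))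
  sound {X} {Y} (T (x , a) X⊢xY xX⊢Y) Z X⊆Z refutes = inconsistent-∷ cut
    where
    cut : ∀ b → Inconsistent ((x , b) ∷ Z)
    -- If `b ≈ a`, the enlarged `Z` contains the left side of the second premise; otherwise
    -- `(x , b)` refutes the cut pair on the right of the first.
    cut b with b ≟ a
    ... | yes b≈a = sound xX⊢Y _
      (λ { (here (y≈x , c≈a)) → here (y≈x , B.Eq.trans c≈a (B.Eq.sym b≈a))
         ; (there p) → there (X⊆Z p) })
      (λ p → let c , c≉ , c∈Z = refutes p in c , c≉ , there c∈Z)
    ... | no b≉a = sound X⊢xY _ (λ p → there (X⊆Z p))
      (λ { (here (y≈x , c≈a)) → b , (λ b≈c → b≉a (B.Eq.trans b≈c c≈a)) , here (y≈x , B.Eq.refl)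
         ; (there p) → let c , c≉ , c∈Z = refutes p in c , c≉ , there c∈Z })

  -- The finite meets and joins of (2) as bounds

  ⋀-lower : ∀ {xs} → Any.Any (x L.≈_) xs → ⋀ xs L.≤ x
  ⋀-lower (here x≈y) = L.trans (L.x∧y≤x _ _) (L.reflexive (L.Eq.sym x≈y))
  ⋀-lower (there x∈xs) = L.trans (L.x∧y≤y _ _) (⋀-lower x∈xs)

  ⋁-upper : ∀ {xs} → Any.Any (x L.≈_) xs → x L.≤ ⋁ xs
  ⋁-upper (here x≈y) = L.trans (L.reflexive x≈y) (L.x≤x∨y _ _)
  ⋁-upper (there x∈xs) = L.trans (⋁-upper x∈xs) (L.y≤x∨y _ _)

  ∈-⟨⟩ : (x , a) ∈ X → a B.≈ b → Any.Any (x L.≈_) (X ⟨ b ⟩)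
  ∈-⟨⟩ {b = b} x∈X a≈b = ∈ₛ.∈-map⁺ S L.setoid proj₁
    (∈ₛ.∈-filter⁺ S (λ p → proj₂ p ≟ b) (λ p≈q p≈b → B.Eq.trans (B.Eq.sym (proj₂ p≈q)) p≈b) x∈X a≈b)

  ∈-above : e B.≤ a → ∃ λ a′ → a′ ∈≡ above e × a B.≈ a′
  ∈-above {e} {a} e≤a =
    let a′ , a′∈ , a≈a′ = ∈-elements a
    in a′ , ∈ₚ.∈-filter⁺ (e ≤?_) a′∈ (B.trans e≤a (B.reflexive a≈a′)) , a≈a′

  collapses⇒≤ : Collapses e X → ⋀[a≥ e ] (λ a → ⋀ (X ⟨ a ⟩)) ≤L ⋁[a≥ e ] (λ a → ⋁ (X ⟨ - a ⟩))
  collapses⇒≤ {e} {X} collapses = collapses _ _ lower upper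
    where
    lower : LowerBound e X _
    lower x∈X e≤a =
      let a′ , a′∈ , a≈a′ = ∈-above e≤a
      in L.trans (⋀-lower (Any.map (λ { refl → L.Eq.refl }) (∈ₚ.∈-map⁺ _ a′∈))) (⋀-lower (∈-⟨⟩ x∈X a≈a′))

    upper : UpperBound e X _
    upper x∈X e≤-a =
      let a′ , a′∈ , -a≈a′ = ∈-above e≤-a
      -- The index is `a′ ≈ - a`, so double complement is needed to find `x` in `X ⟨ - a′ ⟩`.
      in L.trans (⋁-upper (∈-⟨⟩ x∈X (≈-‿swap (B.Eq.sym -a≈a′))))
                 (⋁-upper (Any.map (λ { refl → L.Eq.refl }) (∈ₚ.∈-map⁺ _ a′∈)))

  -- Derivations

  cut₂ : ∀ {p q W} → X ⊢ [ p ] → X ⊢ [ q ] → p ∷ q ∷ [] ⊢ W → X ⊢ W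
  cut₂ {p = p} {q} X⊢p X⊢q pq⊢W =
    T p (weaken X⊢p)
      (T q (M there (Subsetₚ.∷⁺ʳ S q (λ ())) X⊢q)
        (M (λ { (here r) → there (here r) ; (there (here r)) → here r }) (λ r → r) pq⊢W))
    where
    weaken : ∀ {X Y p} → X ⊢ [ p ] → X ⊢ p ∷ Y
    weaken = M (λ r → r) (Subsetₚ.∷⁺ʳ S _ (λ ()))

  -- Only the side of `e` on which the derived value lies is recorded; this survives meets for
  -- `Forces` and joins for `Refuses`.
  Forces Refuses : B.Carrier → FiniteSubset → L.Carrier → Set _
  Forces e X x = ∃ λ a → e B.≤ a × X ⊢ [ (x , a) ]
  Refuses e X x = ∃ λ a → e B.≤ - a × X ⊢ [ (x , a) ]

  forces-⋀ : ∀ {xs} → All (Forces e X) xs → Forces e X (⋀ xs)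
  forces-⋀ [] = B.⊤ , B.maximum _ , M (λ ()) (λ r → r) (axiom ax-1)
  forces-⋀ ((a , e≤a , ⊢a) ∷ forced) =
    let b , e≤b , ⊢b = forces-⋀ forced
    in a B.∧ b , B.∧-greatest e≤a e≤b , cut₂ ⊢a ⊢b (axiom ax-∧)

  refuses-⋁ : ∀ {xs} → All (Refuses e X) xs → Refuses e X (⋁ xs)
  refuses-⋁ [] = B.⊥ , ≤-‿swap (B.minimum _) , M (λ ()) (λ r → r) (axiom ax-0)
  refuses-⋁ ((a , e≤-a , ⊢a) ∷ refused) =
    let b , e≤-b , ⊢b = refuses-⋁ refused
    in a B.∨ b , ≤-‿swap (B.∨-least (≤-‿swap e≤-a) (≤-‿swap e≤-b)) , cut₂ ⊢a ⊢b (axiom ax-∨)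

  derive-∈ : ∀ {ℓ} {P : L.Carrier → Set ℓ} → (∀ {x c} → (x , c) ∈ X → c B.≈ b → P x) → All P (X ⟨ b ⟩)
  derive-∈ {X} {b} h = All.map⁺ (All.tabulate λ p∈ →
    let p∈X , c≈b = ∈ₚ.∈-filter⁻ (λ p → proj₂ p ≟ b) p∈
    in h (Any.map (λ { refl → S.refl }) p∈X) c≈b)

  all-above : ∀ {ℓ} {P : L.Carrier → Set ℓ} (f : B.Carrier → L.Carrier) →
    (∀ {a} → e B.≤ a → P (f a)) → All P (map f (above e))
  all-above {e} f h = All.map⁺ (All.tabulate λ a∈ → h (proj₂ (∈ₚ.∈-filter⁻ (e ≤?_) {xs = elements finite} a∈)))

  -- For the two sides `m` and `j`, `X` derives `(m , a)` with `e ≤ a` and `(j , b)` with `e ≤ - b`,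
  -- hence `(m ∧ j , a ∧ b)`. As `m ∧ j ≈ m`, the element `m` gets two values that differ at `e`,
  -- against (s).
  ≤⇒⊢ : IsAtom e → ⋀[a≥ e ] (λ a → ⋀ (X ⟨ a ⟩)) ≤L ⋁[a≥ e ] (λ a → ⋁ (X ⟨ - a ⟩)) → X ⊢ []
  ≤⇒⊢ {e} {X} atom m≤j = cut₂ ⊢m ⊢m∧j (axiom (ax-s a≉a∧b))
    where
    forced = forces-⋀ (all-above {P = Forces e X} (λ a → ⋀ (X ⟨ a ⟩)) λ e≤a →
      forces-⋀ (derive-∈ {P = Forces e X} λ x∈X c≈a →
        _ , B.trans e≤a (B.reflexive (B.Eq.sym c≈a)) , R x∈X (here S.refl)))
    refused = refuses-⋁ (all-above {P = Refuses e X} (λ a → ⋁ (X ⟨ - a ⟩)) λ e≤a →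
      refuses-⋁ (derive-∈ {P = Refuses e X} λ x∈X c≈-a →
        _ , B.trans e≤a (≤-‿swap (B.reflexive c≈-a)) , R x∈X (here S.refl)))

    ⊢m = proj₂ (proj₂ forced)
    ⊢j = proj₂ (proj₂ refused)

    a≉a∧b : ¬ proj₁ forced B.≈ proj₁ forced B.∧ proj₁ refused
    a≉a∧b a≈a∧b = atom-consistent atom
      (B.trans (proj₁ (proj₂ forced)) (B.trans (B.reflexive a≈a∧b) (B.x∧y≤y _ _)))
      (proj₁ (proj₂ refused))

    m∧j≈m = L.antisym (L.x∧y≤x _ _) (L.∧-greatest L.refl m≤j)
    -- Containment is up to the equality of `L`, so (M) replaces `m ∧ j` by `m`.
    ⊢m∧j = M (λ r → r) (λ { (here (x≈ , c≈)) → here (L.Eq.trans x≈ m∧j≈m , c≈) })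
      (cut₂ ⊢m ⊢j (axiom ax-∧))

theorem3p10 : ∀ {c₁ ℓ₁ ℓ₂ c₂ ℓ₃ ℓ₄}
    (L : BoundedDistributiveLattice c₁ ℓ₁ ℓ₂)
    (B : BooleanAlgebra c₂ ℓ₃ ℓ₄)
    (finite : Finite (BooleanAlgebra.setoid B))
    (discrete : Discrete (BooleanAlgebra.setoid B)) →
    let open LatticeMaps L B finite discrete in
    (X : FiniteSubset) →
    (X ⊢ []) ⇔
    (∃ λ e → IsAtom e × (⋀[a≥ e ] (λ a → ⋀ (X ⟨ a ⟩))) ≤L (⋁[a≥ e ] (λ a → ⋁ (X ⟨ - a ⟩))))
theorem3p10 L B finite discrete X = mk⇔
  (λ X⊢ → let e , atom , collapses = sound L B finite discrete X⊢ X (λ p → p) (λ ())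
          in e , atom , collapses⇒≤ L B finite discrete collapses)
  (λ (e , atom , m≤j) → ≤⇒⊢ L B finite discrete atom m≤j)
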